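{- The following assertion is false: "For every integer $m \ge 1$ and every $A \in \mathbb{Z}^{m\times m}$, letting $S_n$ denote the Smith form (over $\mathbb{Z}$) of $A^n$ normalized to have nonnegative diagonal entries, there exists a periodic sequence $(D_n)_{n\in\mathbb{N}} \subset \mathbb{Z}^{m\times m}$ of diagonal matrices such that $S_{n+1} = D_n S_n$ for all $n \in \mathbb{N}$."
   Context: $\mathbb{N} = \{0,1,2,\dots\}$. A square matrix over $\mathbb{Z}$ is unimodular if its determinant is $\pm 1$. The Smith form of $M \in \mathbb{Z}^{m\times m}$ is the diagonal matrix $S$ with $S_{ii} \mid S_{i+1,i+1}$ for $1 \le i \le m-1$ such that $M = USV$ for some unimodular $U, V \in \mathbb{Z}^{m\times m}$; it is unique once its diagonal entries are required to be nonnegative (zero diagonal entries are allowed). A sequence $(f(n))_{n\in\mathbb{N}}$ is periodic if there exists an integer $T>0$ such that $f(n+T)=f(n)$ for all $n \in \mathbb{N}$. -}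

module Defs where

open import Data.Bool.Base using (if_then_else_)
open import Data.Fin.Base using (Fin; zero; suc; toℕ; punchIn)
open import Data.Fin.Properties using (_≟_)
open import Data.Integer.Base using (ℤ; _+_; _*_; _^_; _≤_; 0ℤ; 1ℤ; -1ℤ)
open import Data.Integer.Divisibility.Signed using (_∣_)
open import Data.Integer.Properties using (+-*-semiring)
open import Data.Nat.Base as ℕ using (ℕ; zero; suc)
open import Data.Product.Base using (_×_; ∃-syntax)
open import Data.Sum.Base using (_⊎_)
open import Data.Vec.Functional using (Vector)
open import Relation.Binary.PropositionalEquality.Core using (_≡_; _≢_)
open import Relation.Nullary.Decidable.Core using (does)
open import Algebra.Properties.Semiring.Sum +-*-semiring using (sum-syntax)

SqMatrix : ℕ → Set
SqMatrix m = Vector (Vector ℤ m) m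

-- Matrices are functions, so they are compared entrywise: without function
-- extensionality, propositional equality would be too strong.
infix 4 _≈_
_≈_ : ∀ {m} → SqMatrix m → SqMatrix m → Set
M ≈ N = ∀ i j → M i j ≡ N i j

infixl 7 _⊗_
_⊗_ : ∀ {m} → SqMatrix m → SqMatrix m → SqMatrix m
_⊗_ {m} M N i j = ∑[ k < m ] (M i k * N k j)

𝟙 : ∀ {m} → SqMatrix m
𝟙 i j = if does (i ≟ j) then 1ℤ else 0ℤ

infixr 8 _^ᴹ_
_^ᴹ_ : ∀ {m} → SqMatrix m → ℕ → SqMatrix m
M ^ᴹ zero  = 𝟙
M ^ᴹ suc n = M ⊗ M ^ᴹ n

-- Laplace expansion along the first row; punchIn j skips column j.
det : ∀ {m} → SqMatrix m → ℤ
det {zero}  M = 1ℤ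
det {suc m} M =
  ∑[ j < suc m ] (-1ℤ ^ toℕ j * M zero j * det (λ i k → M (suc i) (punchIn j k)))

Unimodular : ∀ {m} → SqMatrix m → Set
Unimodular M = det M ≡ 1ℤ ⊎ det M ≡ -1ℤ

Diagonal : ∀ {m} → SqMatrix m → Set
Diagonal M = ∀ i j → i ≢ j → M i j ≡ 0ℤ

-- The normalized Smith form is unique, so this relation determines S from M
-- up to _≈_.
record IsSmithFormOf {m : ℕ} (M S : SqMatrix m) : Set where
  field
    diagonal    : Diagonal S
    chain       : ∀ i j → toℕ j ≡ suc (toℕ i) → S i i ∣ S j j
    nonNegative : ∀ i → 0ℤ ≤ S i i
    equivalent  : ∃[ U ] ∃[ V ] Unimodular U × Unimodular V × M ≈ U ⊗ S ⊗ V

Periodic : ∀ {m} → (ℕ → SqMatrix m) → Set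
Periodic f = ∃[ T ] 0 ℕ.< T × (∀ n → f (n ℕ.+ T) ≈ f n)

{-# OPTIONS --safe #-}

-- For A = (2 1 ; 0 0) one has A^(n+1) = 2^n A, and the gcd of the entries of A
-- is 1, so the top left entries of S_0, S_1, S_2, … are 1, 1, 2, 4, 8, …  The
-- ratio of consecutive entries is 1 at n = 0 and 2 ever after, so a period of D
-- starting from n = 0 is impossible.
module Submission where

open import Defs
open import Data.Fin.Base using (zero; suc)
open import Data.Integer.Base using (ℤ; +_; _+_; _*_; 0ℤ; 1ℤ; +≤+)
open import Data.Integer.Divisibility.Signed using (_∣_; divides; ∣-refl)
open import Data.Integer.Properties using (+-injective; pos-*; *-identityˡ; *-identityʳ; *-zeroʳ)
open import Data.Integer.Tactic.RingSolver using (solve-∀)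
open import Data.Nat.Base as ℕ using (ℕ; zero; suc; _≤_; z≤n; s≤s)
import Data.Nat.Properties as ℕ
open import Data.Product.Base using (_×_; _,_; ∃-syntax)
open import Data.Sum.Base using (inj₁)
open import Data.Vec.Functional using ([]; _∷_)
open import Relation.Binary.PropositionalEquality
  using (_≡_; refl; sym; trans; cong; cong₂; module ≡-Reasoning)
open import Relation.Nullary.Negation.Core using (¬_; contradiction)

open ≡-Reasoning

matrix₂ : ℤ → ℤ → ℤ → ℤ → SqMatrix 2
matrix₂ a b c d = (a ∷ b ∷ []) ∷ (c ∷ d ∷ []) ∷ []

diagonal₂ : ℤ → ℤ → SqMatrix 2
diagonal₂ a d = matrix₂ a 0ℤ 0ℤ d

diagonal₂-diagonal : ∀ a d → Diagonal (diagonal₂ a d)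
diagonal₂-diagonal a d zero       zero       i≢j = contradiction refl i≢j
diagonal₂-diagonal a d zero       (suc zero) i≢j = refl
diagonal₂-diagonal a d (suc zero) zero       i≢j = refl
diagonal₂-diagonal a d (suc zero) (suc zero) i≢j = contradiction refl i≢j

-- Taking the diagonal entries from `ℕ` settles nonnegativity at once, and in size 2 the
-- divisibility chain has a single link.
diagonal₂-isSmithForm : ∀ {M : SqMatrix 2} (a d : ℕ) → + a ∣ + d →
  ∃[ U ] ∃[ V ] Unimodular U × Unimodular V × M ≈ U ⊗ diagonal₂ (+ a) (+ d) ⊗ V →
  IsSmithFormOf M (diagonal₂ (+ a) (+ d))
diagonal₂-isSmithForm a d a∣d equiv = record
  { diagonal    = diagonal₂-diagonal (+ a) (+ d)
  ; chain       = λ { zero       zero       ()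
                    ; zero       (suc zero) _ → a∣d
                    ; (suc zero) zero       ()
                    ; (suc zero) (suc zero) ()
                    }
  ; nonNegative = λ { zero → +≤+ z≤n ; (suc zero) → +≤+ z≤n }
  ; equivalent  = equiv
  }

A : SqMatrix 2
A = matrix₂ (+ 2) 1ℤ 0ℤ 0ℤ

S : ℕ → SqMatrix 2
S zero    = diagonal₂ 1ℤ 1ℤ
S (suc n) = diagonal₂ (+ (2 ℕ.^ n)) 0ℤ

-- As `A` has trace 2 and determinant 0, Cayley-Hamilton gives `A ⊗ A` equal to twice `A` (checked
-- entrywise in `A²`), so each further factor `A` only doubles the scalar.
A^suc : ∀ n → A ^ᴹ suc n ≈ λ i j → + (2 ℕ.^ n) * A i j
A^suc zero zero       zero       = refl
A^suc zero zero       (suc zero) = refl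
A^suc zero (suc zero) zero       = refl
A^suc zero (suc zero) (suc zero) = refl
A^suc (suc n) i j = begin
  A i zero * (A ^ᴹ suc n) zero j + (A i (suc zero) * (A ^ᴹ suc n) (suc zero) j + 0ℤ)
    ≡⟨ cong₂ (λ x y → A i zero * x + (A i (suc zero) * y + 0ℤ))
         (A^suc n zero j) (A^suc n (suc zero) j) ⟩
  A i zero * (p * A zero j) + (A i (suc zero) * (p * A (suc zero) j) + 0ℤ)
    ≡⟨ factor p (A i zero) (A zero j) (A i (suc zero)) (A (suc zero) j) ⟩
  p * (A ⊗ A) i j
    ≡⟨ cong (p *_) (A² i j) ⟩
  p * (+ 2 * A i j)
    ≡⟨ swap p (A i j) ⟩
  + 2 * p * A i j
    ≡⟨ cong (_* A i j) (pos-* 2 (2 ℕ.^ n)) ⟨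
  + (2 ℕ.^ suc n) * A i j ∎
  where
  p = + (2 ℕ.^ n)

  factor : ∀ p a b c d →
    a * (p * b) + (c * (p * d) + 0ℤ) ≡ p * (a * b + (c * d + 0ℤ))
  factor = solve-∀

  swap : ∀ p a → p * (+ 2 * a) ≡ + 2 * p * a
  swap = solve-∀

  A² : A ⊗ A ≈ λ i j → + 2 * A i j
  A² zero       zero       = refl
  A² zero       (suc zero) = refl
  A² (suc zero) zero       = refl
  A² (suc zero) (suc zero) = refl

S-isSmithForm : ∀ n → IsSmithFormOf (A ^ᴹ n) (S n)
S-isSmithForm zero = diagonal₂-isSmithForm 1 1 ∣-refl
  (𝟙 , 𝟙 , inj₁ refl , inj₁ refl ,
   λ { zero       zero       → refl
     ; zero       (suc zero) → refl
     ; (suc zero) zero       → refl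
     ; (suc zero) (suc zero) → refl
     })
-- The lower right entry is 0, which every integer divides.
S-isSmithForm (suc n) = diagonal₂-isSmithForm (2 ℕ.^ n) 0 (divides 0ℤ refl)
  (𝟙 , V , inj₁ refl , inj₁ refl ,
   λ i j → trans (A^suc n i j) (factorisation (+ (2 ℕ.^ n)) i j))
  where
  -- The first row is that of `A`; its entries are coprime, so it can be completed to determinant 1.
  -- The zero row of `A` then comes from the zero in the diagonal matrix.
  V : SqMatrix 2
  V = matrix₂ (+ 2) 1ℤ 1ℤ 1ℤ

  -- The right-hand side is what a first-row entry of the triple product reduces to once its closed
  -- zero terms have evaluated.
  topRow : ∀ p v → p * v ≡ (1ℤ * p + 0ℤ) * v + 0ℤ
  topRow = solve-∀

  factorisation : ∀ p → (λ i j → p * A i j) ≈ 𝟙 ⊗ diagonal₂ p 0ℤ ⊗ V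
  factorisation p zero       zero       = topRow p (+ 2)
  factorisation p zero       (suc zero) = topRow p 1ℤ
  factorisation p (suc zero) zero       = *-zeroʳ p
  factorisation p (suc zero) (suc zero) = *-zeroʳ p

S-noPeriodicRatio : ∀ D → Periodic D → ¬ (∀ n → S (suc n) ≈ D n ⊗ S n)
-- A positive period has the form `suc t`, so `S` at that index is already in its geometric range.
S-noPeriodicRatio D (suc t , _ , periodic) ratio =
  ℕ.<⇒≢ (ℕ.^-monoʳ-< 2 (s≤s (s≤s z≤n)) (ℕ.n<1+n t)) (sym (+-injective 2^[1+t]≡2^t))
  where
  -- The off-diagonal entry `y` of `D n` meets the zero below the top left entry of `S n`.
  topLeft : ∀ x y p → x * p + (y * 0ℤ + 0ℤ) ≡ x * p
  topLeft = solve-∀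

  D₀≡1 : D 0 zero zero ≡ 1ℤ
  D₀≡1 = begin
    D 0 zero zero            ≡⟨ *-identityʳ (D 0 zero zero) ⟨
    D 0 zero zero * 1ℤ       ≡⟨ topLeft (D 0 zero zero) (D 0 zero (suc zero)) 1ℤ ⟨
    (D 0 ⊗ S 0) zero zero    ≡⟨ ratio 0 zero zero ⟨
    1ℤ                       ∎

  2^[1+t]≡2^t : + (2 ℕ.^ suc t) ≡ + (2 ℕ.^ t)
  2^[1+t]≡2^t = begin
    + (2 ℕ.^ suc t)                       ≡⟨ ratio (suc t) zero zero ⟩
    (D (suc t) ⊗ S (suc t)) zero zero     ≡⟨ topLeft (D (suc t) zero zero) (D (suc t) zero (suc zero)) (+ (2 ℕ.^ t)) ⟩
    -- Periodicity at index 0 carries the initial ratio 1 to index `suc t`, where the powers of 2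
    -- force ratio 2.
    D (suc t) zero zero * + (2 ℕ.^ t)     ≡⟨ cong (_* + (2 ℕ.^ t)) (periodic 0 zero zero) ⟩
    D 0 zero zero * + (2 ℕ.^ t)           ≡⟨ cong (_* + (2 ℕ.^ t)) D₀≡1 ⟩
    1ℤ * + (2 ℕ.^ t)                      ≡⟨ *-identityˡ (+ (2 ℕ.^ t)) ⟩
    + (2 ℕ.^ t)                           ∎

proposition1p2 : ¬ (∀ (m : ℕ) → 1 ≤ m → (A : SqMatrix m) (S : ℕ → SqMatrix m) →
    (∀ n → IsSmithFormOf (A ^ᴹ n) (S n)) →
    ∃[ D ] Periodic D × (∀ n → Diagonal (D n)) × (∀ n → S (suc n) ≈ D n ⊗ S n))
proposition1p2 claim with claim 2 (s≤s z≤n) A S S-isSmithForm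
... | D , periodic , _ , ratio = S-noPeriodicRatio D periodic ratio
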